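{- Let $\mathcal{P} \subset \mathbb{R}^d$ be a locally anti-blocking lattice polytope of dimension $d$, and for each $\varepsilon \in \{ -1,1\}^d$ let $\mathcal{P}_{\varepsilon} \subset \mathbb{R}^d_{\ge 0}$ be an anti-blocking lattice polytope of dimension $d$ such that $\mathcal{P} \cap \mathbb{R}^d_\varepsilon = \mathcal{P}_{\varepsilon}^\pm \cap \mathbb{R}^d_\varepsilon$. Then $$h^*(\mathcal{P}, x) = \frac{1}{2^{d}}\sum_{\varepsilon \in \{ -1,1\}^d} h^*(\mathcal{P}_{\varepsilon}^\pm, x).$$ In particular, $h^*(\mathcal{P},x)$ is $\gamma$-positive if $h^*(\mathcal{P}_{\varepsilon}^{\pm},x)$ is $\gamma$-positive for all $\varepsilon \in \{ -1,1\}^d$.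
   Context: A lattice polytope is a convex polytope whose vertices lie in $\mathbb{Z}^d$. A lattice polytope $\mathcal{P}\subset\mathbb{R}^d_{\ge0}$ of dimension $d$ is anti-blocking if whenever $\mathbf{y}\in\mathcal{P}$ and $\mathbf{x}\in\mathbb{R}^d$ with $0\le x_i\le y_i$ for all $i$, then $\mathbf{x}\in\mathcal{P}$. For $\varepsilon\in\{ -1,1\}^d$ and $\mathbf{x}\in\mathbb{R}^d$ write $\varepsilon\mathbf{x}=(\varepsilon_1x_1,\dots,\varepsilon_dx_d)$, and for an anti-blocking $\mathcal{P}$ put $\mathcal{P}^\pm=\{\varepsilon\mathbf{x}:\varepsilon\in\{ -1,1\}^d,\ \mathbf{x}\in\mathcal{P}\}$ (a lattice polytope). Let $\mathbb{R}^d_\varepsilon=\{\mathbf{x}\in\mathbb{R}^d: \varepsilon_ix_i\ge0 \text{ for all } i\}$. A lattice polytope $\mathcal{P}\subset\mathbb{R}^d$ of dimension $d$ is locally anti-blocking if for each $\varepsilon\in\{ -1,1\}^d$ there exists an anti-blocking lattice polytope $\mathcal{P}_\varepsilon\subset\mathbb{R}^d_{\ge0}$ of dimension $d$ with $\mathcal{P}\cap\mathbb{R}^d_\varepsilon=\mathcal{P}_\varepsilon^\pm\cap\mathbb{R}^d_\varepsilon$. For a lattice polytope $\mathcal{Q}\subset\mathbb{R}^n$ of dimension $k$, its $h^*$-polynomial is defined by $1+\sum_{m\ge1}|m\mathcal{Q}\cap\mathbb{Z}^n|x^m = h^*(\mathcal{Q},x)/(1-x)^{k+1}$. A polynomial $f$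 of degree $d$ is $\gamma$-positive if it is palindromic ($f(x)=x^df(1/x)$) and $f(x)=\sum_{i=0}^{\lfloor d/2\rfloor}\gamma_i x^i(1+x)^{d-2i}$ with all $\gamma_i\ge0$.
   Formalization: The polytopes are taken as sets of rational points: the ambient space, convex combinations, and the anti-blocking and orthant conditions use rational instead of real coordinates; the lattice-point counts, and so the h*-polynomials, are the same. -}

module Defs where

open import Data.Nat as ℕ using (ℕ; zero; suc; _∸_; _<_; _/_)
open import Data.Nat.Combinatorics using (_C_)
open import Data.Integer as ℤ using (ℤ; +_)
open import Data.Rational as ℚ using (ℚ; 0ℚ; 1ℚ)
open import Data.Bool using (Bool; true; false)
open import Data.Fin using (Fin; zero; suc)
open import Data.Vec as Vec using (Vec; []; _∷_)
open import Data.List as List using (List; []; _∷_; length)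
open import Data.List.Membership.Propositional using (_∈_)
open import Data.List.Relation.Unary.Unique.Propositional using (Unique)
open import Data.Product using (Σ; _×_)
open import Function.Bundles using (_⇔_)
open import Relation.Binary.PropositionalEquality using (_≡_; _≢_)

Pt : ℕ → Set
Pt d = Vec ℚ d

Region : ℕ → Set₁
Region d = Pt d → Set

toℚ : ℤ → ℚ
toℚ z = z ℚ./ 1

toℚᵛ : ∀ {d} → Vec ℤ d → Pt d
toℚᵛ = Vec.map toℚ

sumFinℚ : ∀ {n} → (Fin n → ℚ) → ℚ
sumFinℚ {zero}  f = 0ℚ
sumFinℚ {suc n} f = f zero ℚ.+ sumFinℚ (λ k → f (suc k))

dot : ∀ {d} → Pt d → Pt d → ℚ
dot []       []       = 0ℚ
dot (a ∷ as) (x ∷ xs) = a ℚ.* x ℚ.+ dot as xs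

Conv : ∀ {d} → List (Vec ℤ d) → Region d
Conv {d} V x =
  Σ (Fin (length V) → ℚ) λ lam →
    (∀ k → 0ℚ ℚ.≤ lam k) ×
    (sumFinℚ lam ≡ 1ℚ) ×
    (∀ (i : Fin d) → sumFinℚ (λ k → lam k ℚ.* toℚ (Vec.lookup (List.lookup V k) i)) ≡ Vec.lookup x i)

NonEmpty : ∀ {A : Set} → List A → Set
NonEmpty xs = 0 < length xs

-- conv V has dimension d: its affine hull is all of ℚ^d, i.e. the only
-- affine equation a·v = c satisfied by all vertices has a = 0.
FullDim : ∀ {d} → List (Vec ℤ d) → Set
FullDim {d} V = ∀ (a : Pt d) (c : ℚ) → (∀ v → v ∈ V → dot a (toℚᵛ v) ≡ c) → a ≡ Vec.replicate d 0ℚ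

AntiBlocking : ∀ {d} → Region d → Set
AntiBlocking {d} R =
  (∀ y → R y → ∀ (i : Fin d) → 0ℚ ℚ.≤ Vec.lookup y i) ×
  (∀ y x → R y → (∀ (i : Fin d) → (0ℚ ℚ.≤ Vec.lookup x i) × (Vec.lookup x i ℚ.≤ Vec.lookup y i)) → R x)

signℚ : Bool → ℚ → ℚ
signℚ true  q = q
signℚ false q = ℚ.- q

applySign : ∀ {d} → Vec Bool d → Pt d → Pt d
applySign = Vec.zipWith signℚ

allSigns : (d : ℕ) → List (Vec Bool d)
allSigns zero    = [] ∷ []
allSigns (suc d) = List.map (true ∷_) (allSigns d) List.++ List.map (false ∷_) (allSigns d)

Pm : ∀ {d} → Region d → Region d
Pm {d} R x = Σ (Vec Bool d) λ ε → R (applySign ε x)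

OrthCoord : Bool → ℚ → Set
OrthCoord true  q = 0ℚ ℚ.≤ q
OrthCoord false q = q ℚ.≤ 0ℚ

InOrthant : ∀ {d} → Vec Bool d → Pt d → Set
InOrthant {d} ε x = ∀ (i : Fin d) → OrthCoord (Vec.lookup ε i) (Vec.lookup x i)

InDilate : ∀ {d} → Region d → ℕ → Vec ℤ d → Set
InDilate {d} R m z = Σ (Pt d) λ x → R x × (Vec.map (λ q → toℚ (+ m) ℚ.* q) x ≡ toℚᵛ z)

LatticeCount : ∀ {d} → Region d → ℕ → ℕ → Set
LatticeCount {d} R m n =
  Σ (List (Vec ℤ d)) λ L → Unique L × (∀ z → (z ∈ L) ⇔ InDilate R m z) × (length L ≡ n)

sumTo : (ℕ → ℤ) → ℕ → ℤ
sumTo f zero    = f 0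
sumTo f (suc n) = sumTo f n ℤ.+ f (suc n)

-- coefficient of x^m in h(x)/(1-x)^{k+1}
seriesCoeff : (ℕ → ℤ) → ℕ → ℕ → ℤ
seriesCoeff h k m = sumTo (λ j → h j ℤ.* + ((m ∸ j ℕ.+ k) C k)) m

Polynomial : (ℕ → ℤ) → Set
Polynomial h = Σ ℕ λ N → ∀ i → N < i → h i ≡ + 0

-- h is the h*-polynomial of the region R of dimension k:
-- 1 + Σ_{m≥1} |m R ∩ ℤ^d| x^m = h(x)/(1-x)^{k+1}
IsHStar : ∀ {d} → Region d → ℕ → (ℕ → ℤ) → Set
IsHStar R k h =
  Polynomial h ×
  (seriesCoeff h k 0 ≡ + 1) ×
  (∀ m → Σ ℕ λ n → LatticeCount R (suc m) n × (+ n ≡ seriesCoeff h k (suc m)))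

-- coefficient of x^i in x^j (1+x)^{n-2j}
gammaBasis : ℕ → ℕ → ℕ → ℕ
gammaBasis n j i with j ℕ.≤ᵇ i
... | true  = (n ∸ (j ℕ.+ j)) C (i ∸ j)
... | false = 0

GammaPositive : (ℕ → ℤ) → Set
GammaPositive f =
  Σ ℕ λ n →
    (f n ≢ + 0) × (∀ i → n < i → f i ≡ + 0) ×
    (∀ i → i ℕ.≤ n → f i ≡ f (n ∸ i)) ×
    Σ (ℕ → ℤ) λ γ → (∀ j → + 0 ℤ.≤ γ j) ×
      (∀ i → f i ≡ sumTo (λ j → γ j ℤ.* + gammaBasis n j i) (n / 2))

sumℤ : List ℤ → ℤ
sumℤ = List.foldr ℤ._+_ (+ 0)

{-# OPTIONS --safe #-}
module Submission where

-- Exchanging, in every nonzero coordinate, the sign of z with the entry of ε is an involution of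
-- {±1}^d × ℤ^d. It sends (ε , z) to some (η , w) with w in the orthant of ε and w a coordinate
-- reflection of z, so it matches the pairs with z ∈ m P_ε^± with the pairs with w ∈ m P. Hence
-- 2^d |mP ∩ ℤ^d| is the sum of the |m P_ε^± ∩ ℤ^d|. The linear systems defining h* (and the
-- γ-vector) are unitriangular over ℤ, so divisibility by 2^d passes to their solutions.
--
-- For γ-positivity all h*(P_ε^±) must be palindromic of the same degree. Because z ↦ -z fixes only
-- the origin, every |m P_ε^± ∩ ℤ^d| is odd, whence h*(P_ε^±) ≡ (1-x)^d mod 2; a palindromic such
-- polynomial with constant term 1 has degree exactly d.

open import Defs
open import Data.Nat using (ℕ; _^_)
open import Data.Integer using (ℤ; +_; _*_)
open import Data.Bool using (Bool)
open import Data.Vec using (Vec)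
open import Data.List using (List; map)
open import Data.Product using (Σ; _×_)
open import Function.Bundles using (_⇔_)
open import Relation.Binary.PropositionalEquality using (_≡_)

open import Algebra.Properties.CommutativeSemigroup using (interchange)
import Algebra.Properties.Group
open import Data.Bool using (true; false; not; T)
import Data.Bool.Properties as Bool
open import Data.Empty using (⊥-elim)
open import Data.Fin using (Fin; zero; suc)
open import Data.Integer using (-[1+_]; +[1+_]; ∣_∣)
import Data.Integer as ℤ hiding (+_)
import Data.Integer.Properties as ℤ
open import Data.Integer.Divisibility.Signed
  using (_∣_; divides; ∣m∣n⇒∣m+n; ∣m+n∣m⇒∣n; ∣m+n∣n⇒∣m; ∣m⇒∣m*n)
open import Data.List using ([]; _∷_; _++_; length; filter; deduplicate; concatMap)
import Data.List as List
open import Data.List.Properties using (length-map; length-++)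
open import Data.List.Membership.Propositional using (_∈_; _∉_; lose)
open import Data.List.Membership.Propositional.Properties
  using (∈-∃++; ∈-map⁺; ∈-map⁻; ∈-++⁺ˡ; ∈-++⁺ʳ; ∈-++⁻; ∈-filter⁺; ∈-filter⁻; ∈-deduplicate⁺; ∈-concatMap⁺)
import Data.List.Relation.Unary.All as All
open import Data.List.Relation.Unary.All.Properties using (All¬⇒¬Any)
open import Data.List.Relation.Unary.AllPairs using ([]; _∷_)
open import Data.List.Relation.Unary.Any using (here; there)
open import Data.List.Relation.Unary.Unique.Propositional using (Unique)
import Data.List.Relation.Unary.Unique.Propositional.Properties as Unique
import Data.List.Relation.Unary.Unique.DecPropositional.Properties as DecUnique
import Data.List.Membership.DecPropositional as DecMembership
open import Data.Nat using (zero; suc; _+_; _∸_; _≤_; _<_; _/_; z≤n; s≤s; _⊔_; _≤ᵇ_)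
import Data.Nat as ℕ
import Data.Nat.Properties as ℕ
open import Data.Nat.Combinatorics using (_C_; nCn≡1; nCk+nC[k+1]≡[n+1]C[k+1])
open import Data.Product using (_,_; proj₁; proj₂)
open import Data.Product.Properties using (,-injectiveʳ)
open import Data.Rational using (ℚ; 0ℚ; 1ℚ)
import Data.Rational as ℚ
import Data.Rational.Properties as ℚ
open import Data.Sum using (_⊎_; inj₁; inj₂)
open import Data.Vec using ([]; _∷_; zipWith; replicate; lookup)
import Data.Vec as Vec
import Data.Vec.Properties as Vec
open import Function using (_∘_)
open import Function.Bundles using (mk⇔; Equivalence)
open import Relation.Binary.PropositionalEquality
  using (_≢_; refl; sym; trans; cong; cong₂; subst; module ≡-Reasoning)
open import Relation.Nullary using (¬_; yes; no)

open Equivalence using (to; from)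
open Algebra.Properties.Group ℚ.+-0-group using (⁻¹-involutive)

private variable
  A B : Set
  d : ℕ

-- Finite sums and triangular systems

sumTo-cong : ∀ {f g : ℕ → ℤ} m → (∀ j → j ≤ m → f j ≡ g j) → sumTo f m ≡ sumTo g m
sumTo-cong zero    eq = eq 0 z≤n
sumTo-cong (suc m) eq =
  cong₂ ℤ._+_ (sumTo-cong m (λ j j≤m → eq j (ℕ.m≤n⇒m≤1+n j≤m))) (eq (suc m) ℕ.≤-refl)

sumTo-+ : ∀ (f g : ℕ → ℤ) m → sumTo (λ j → f j ℤ.+ g j) m ≡ sumTo f m ℤ.+ sumTo g m
sumTo-+ f g zero    = refl
sumTo-+ f g (suc m) = trans
  (cong (ℤ._+ (f (suc m) ℤ.+ g (suc m))) (sumTo-+ f g m))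
  (interchange ℤ.+-commutativeSemigroup (sumTo f m) (sumTo g m) (f (suc m)) (g (suc m)))

sumTo-0 : ∀ m → sumTo (λ _ → + 0) m ≡ + 0
sumTo-0 zero    = refl
sumTo-0 (suc m) = trans (ℤ.+-identityʳ _) (sumTo-0 m)

sumTo-* : ∀ c (f : ℕ → ℤ) m → sumTo (λ j → c * f j) m ≡ c * sumTo f m
sumTo-* c f zero    = refl
sumTo-* c f (suc m) = trans
  (cong (ℤ._+ c * f (suc m)) (sumTo-* c f m))
  (sym (ℤ.*-distribˡ-+ c (sumTo f m) (f (suc m))))

sumTo-truncate : ∀ (f : ℕ → ℤ) {i n} → i ≤ n → (∀ j → i < j → f j ≡ + 0) → sumTo f n ≡ sumTo f i
sumTo-truncate f {i} {n} i≤n vanish =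
  subst (λ n → sumTo f n ≡ sumTo f i) (ℕ.m∸n+n≡m i≤n) (extend (n ∸ i))
  where
  extend : ∀ k → sumTo f (k + i) ≡ sumTo f i
  extend zero    = refl
  extend (suc k) = trans
    (cong₂ ℤ._+_ (extend k) (vanish (suc k + i) (s≤s (ℕ.m≤n+m i k))))
    (ℤ.+-identityʳ _)

sumTo-∣ : ∀ {c} {f : ℕ → ℤ} m → (∀ j → j ≤ m → c ∣ f j) → c ∣ sumTo f m
sumTo-∣ zero    c∣f = c∣f 0 z≤n
sumTo-∣ (suc m) c∣f =
  ∣m∣n⇒∣m+n (sumTo-∣ m (λ j j≤m → c∣f j (ℕ.m≤n⇒m≤1+n j≤m))) (c∣f (suc m) ℕ.≤-refl)

-- Forward substitution: in row m the entry `a m` has coefficient 1 and the earlier entries are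
-- already divisible by c, so nothing has to be inverted. The bound n matters for the γ-vector,
-- where only finitely many rows are of this triangular form.
unitriangular-∣ : ∀ {c} (a : ℕ → ℤ) (u : ℕ → ℕ → ℕ) → (∀ m → u m m ≡ 1) → ∀ n →
  (∀ m → m ≤ n → c ∣ sumTo (λ j → a j * + u m j) m) → ∀ m → m ≤ n → c ∣ a m
unitriangular-∣ {c} a u diag n c∣sum m m≤n = below m m≤n m ℕ.≤-refl
  where
  diagonal : ∀ m → a m * + u m m ≡ a m
  diagonal m = trans (cong (λ k → a m * + k) (diag m)) (ℤ.*-identityʳ (a m))

  below : ∀ k → k ≤ n → ∀ j → j ≤ k → c ∣ a j
  below zero    k≤n zero z≤n = subst (c ∣_) (diagonal 0) (c∣sum 0 k≤n)
  below (suc k) k<n j j≤k with ℕ.m≤n⇒m<n∨m≡n j≤k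
  ... | inj₁ (s≤s j≤k′) = below k (ℕ.<⇒≤ k<n) j j≤k′
  ... | inj₂ refl = subst (c ∣_) (diagonal (suc k))
    (∣m+n∣m⇒∣n (c∣sum (suc k) k<n)
      (sumTo-∣ k (λ j j≤k → ∣m⇒∣m*n _ (below k (ℕ.<⇒≤ k<n) j j≤k))))

-- Sums of integers over a list of indices

sumOver : List A → (A → ℤ) → ℤ
sumOver es f = sumℤ (map f es)

sumOver-cong : ∀ (es : List A) {f g : A → ℤ} → (∀ e → f e ≡ g e) → sumOver es f ≡ sumOver es g
sumOver-cong []       eq = refl
sumOver-cong (e ∷ es) eq = cong₂ ℤ._+_ (eq e) (sumOver-cong es eq)

sumOver-1 : (es : List A) → sumOver es (λ _ → + 1) ≡ + length es
sumOver-1 []       = refl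
sumOver-1 (e ∷ es) = cong (ℤ._+_ (+ 1)) (sumOver-1 es)

sumOver-0 : (es : List A) → sumOver es (λ _ → + 0) ≡ + 0
sumOver-0 []       = refl
sumOver-0 (e ∷ es) = trans (ℤ.+-identityˡ _) (sumOver-0 es)

sumOver-nonNeg : ∀ (es : List A) {f : A → ℤ} → (∀ e → + 0 ℤ.≤ f e) → + 0 ℤ.≤ sumOver es f
sumOver-nonNeg []       0≤f = ℤ.≤-refl
sumOver-nonNeg (e ∷ es) 0≤f = ℤ.+-mono-≤ (0≤f e) (sumOver-nonNeg es 0≤f)

sumOver-sumTo : ∀ (es : List A) (a : A → ℕ → ℤ) (w : ℕ → ℤ) m →
  sumOver es (λ e → sumTo (λ j → a e j * w j) m) ≡ sumTo (λ j → sumOver es (λ e → a e j) * w j) m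
sumOver-sumTo []       a w m = sym (sumTo-0 m)
sumOver-sumTo (e ∷ es) a w m = begin
  sumTo (λ j → a e j * w j) m ℤ.+ sumOver es (λ e → sumTo (λ j → a e j * w j) m)
    ≡⟨ cong (ℤ._+_ (sumTo (λ j → a e j * w j) m)) (sumOver-sumTo es a w m) ⟩
  sumTo (λ j → a e j * w j) m ℤ.+ sumTo (λ j → sumOver es (λ e → a e j) * w j) m
    ≡⟨ sumTo-+ _ _ m ⟨
  sumTo (λ j → a e j * w j ℤ.+ sumOver es (λ e → a e j) * w j) m
    ≡⟨ sumTo-cong m (λ j _ → sym (ℤ.*-distribʳ-+ (w j) (a e j) (sumOver es (λ e → a e j)))) ⟩
  sumTo (λ j → (a e j ℤ.+ sumOver es (λ e → a e j)) * w j) m ∎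
  where open ≡-Reasoning

sumTo-scale : ∀ {a b : ℕ → ℤ} c (w : ℕ → ℤ) m → (∀ j → j ≤ m → c * a j ≡ b j) →
  c * sumTo (λ j → a j * w j) m ≡ sumTo (λ j → b j * w j) m
sumTo-scale {a} {b} c w m ca≡b = trans (sym (sumTo-* c _ m)) (sumTo-cong m λ j j≤m →
  trans (sym (ℤ.*-assoc c (a j) (w j))) (cong (_* w j) (ca≡b j j≤m)))

-- Coefficients of h(x)/(1-x)^{k+1}

seriesCoeff-diag : ∀ k m → (m ∸ m + k) C k ≡ 1
seriesCoeff-diag k m rewrite ℕ.n∸n≡0 m = nCn≡1 k

seriesCoeff-0 : ∀ h k → seriesCoeff h k 0 ≡ h 0
seriesCoeff-0 h k = trans (cong (λ c → h 0 * + c) (nCn≡1 k)) (ℤ.*-identityʳ (h 0))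

-- Coefficient form of (1-x) · h/(1-x)^{k+2} = h/(1-x)^{k+1}; it is Pascal's rule in each summand.
seriesCoeff-suc : ∀ h k m →
  seriesCoeff h (suc k) (suc m) ≡ seriesCoeff h (suc k) m ℤ.+ seriesCoeff h k (suc m)
seriesCoeff-suc h k m = begin
  sumTo (λ j → h j * + ((suc m ∸ j + suc k) C suc k)) m ℤ.+ h (suc m) * + ((m ∸ m + suc k) C suc k)
    -- The summand j = `suc m` has no partner in the shorter sum; its binomial coefficient is 1 for
    -- `suc k` and for k alike.
    ≡⟨ cong₂ ℤ._+_ (sumTo-cong m pascal)
        (cong (λ c → h (suc m) * + c) (trans (seriesCoeff-diag (suc k) m) (sym (seriesCoeff-diag k m)))) ⟩
  sumTo (λ j → h j * + ((m ∸ j + suc k) C suc k) ℤ.+ h j * + ((suc m ∸ j + k) C k)) m ℤ.+ last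
    ≡⟨ cong (ℤ._+ last) (sumTo-+ _ _ m) ⟩
  (seriesCoeff h (suc k) m ℤ.+ sumTo (λ j → h j * + ((suc m ∸ j + k) C k)) m) ℤ.+ last
    ≡⟨ ℤ.+-assoc (seriesCoeff h (suc k) m) _ last ⟩
  seriesCoeff h (suc k) m ℤ.+ seriesCoeff h k (suc m) ∎
  where
  open ≡-Reasoning
  last = h (suc m) * + ((m ∸ m + k) C k)

  pascal : ∀ j → j ≤ m → h j * + ((suc m ∸ j + suc k) C suc k) ≡
    h j * + ((m ∸ j + suc k) C suc k) ℤ.+ h j * + ((suc m ∸ j + k) C k)
  -- Since j ≤ m, the truncated difference `suc m ∸ j` is a genuine successor, which exposes the
  -- upper index to Pascal's rule.
  pascal j j≤m rewrite ℕ.+-∸-assoc 1 j≤m | sym (ℕ.+-suc (m ∸ j) k) = begin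
    h j * + (suc (m ∸ j + suc k) C suc k)
      ≡⟨ cong (λ c → h j * + c) (nCk+nC[k+1]≡[n+1]C[k+1] (m ∸ j + suc k) k) ⟨
    h j * + ((m ∸ j + suc k) C k + (m ∸ j + suc k) C suc k)
      ≡⟨ cong (λ c → h j * + c) (ℕ.+-comm ((m ∸ j + suc k) C k) _) ⟩
    h j * (+ ((m ∸ j + suc k) C suc k) ℤ.+ + ((m ∸ j + suc k) C k))
      ≡⟨ ℤ.*-distribˡ-+ (h j) (+ ((m ∸ j + suc k) C suc k)) _ ⟩
    h j * + ((m ∸ j + suc k) C suc k) ℤ.+ h j * + ((m ∸ j + suc k) C k) ∎

seriesCoeff-zero-suc : ∀ h m → seriesCoeff h 0 (suc m) ≡ seriesCoeff h 0 m ℤ.+ h (suc m)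
seriesCoeff-zero-suc h m = cong (ℤ._+_ (sumTo (λ j → h j * + 1) m)) (ℤ.*-identityʳ (h (suc m)))

-- Unlike seriesCoeff, indexed by the exponent of 1-x, so that k = 0 gives h itself.
series : (ℕ → ℤ) → ℕ → ℕ → ℤ
series h zero    = h
series h (suc k) = seriesCoeff h k

series-0 : ∀ h k → series h k 0 ≡ h 0
series-0 h zero    = refl
series-0 h (suc k) = seriesCoeff-0 h k

series-suc : ∀ h k m → series h (suc k) (suc m) ≡ series h (suc k) m ℤ.+ series h k (suc m)
series-suc h zero    = seriesCoeff-zero-suc h
series-suc h (suc k) = seriesCoeff-suc h k

2∤1 : ¬ (+ 2 ∣ + 1)
2∤1 (divides (+ zero) ())
2∤1 (divides +[1+ zero ] ())
2∤1 (divides +[1+ suc n ] ())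
2∤1 (divides -[1+ n ] ())

-- A parity pattern that t multiplications of 1 by 1 - x produce mod 2.
EndsOddAt : ℕ → (ℕ → ℤ) → Set
EndsOddAt t g = ¬ (+ 2 ∣ g t) × (∀ m → t < m → + 2 ∣ g m)

-- The hypothesis says that g agrees with (1-x)f from index 1 on. At `suc t` the coefficient is even
-- minus odd, and after it even minus even, so the last odd position moves up by one.
endsOddAt-difference : ∀ {t} {f g : ℕ → ℤ} → (∀ m → f (suc m) ≡ f m ℤ.+ g (suc m)) →
  EndsOddAt t f → EndsOddAt (suc t) g
endsOddAt-difference {t} {f} {g} step (odd , even) =
  (λ even-g → odd (∣m+n∣n⇒∣m (subst (+ 2 ∣_) (step t) (even (suc t) ℕ.≤-refl)) even-g)) ,
  λ { (suc m) (s≤s t<m) → ∣m+n∣m⇒∣n (subst (+ 2 ∣_) (step m) (even (suc m) (ℕ.m≤n⇒m≤1+n t<m))) (even m t<m) }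

-- Each multiplication by 1-x lowers the exponent k by one and moves the last odd position up by
-- one, until h itself is reached.
endsOddAt-series : ∀ h k t → EndsOddAt t (series h k) → EndsOddAt (k + t) h
endsOddAt-series h zero    t ends = ends
endsOddAt-series h (suc k) t ends = subst (λ n → EndsOddAt n h) (ℕ.+-suc k t)
  (endsOddAt-series h k (suc t) (endsOddAt-difference (series-suc h k) ends))

-- If all coefficients of h/(1-x)^{k+1} are odd, then h ≡ (1-x)^k mod 2.
odd-seriesCoeff⇒endsOddAt : ∀ h k → h 0 ≡ + 1 → (∀ m → + 2 ∣ + 1 ℤ.+ seriesCoeff h k m) → EndsOddAt k h
odd-seriesCoeff⇒endsOddAt h k h0≡1 odd = subst (λ n → EndsOddAt n h) (ℕ.+-identityʳ k)
  (endsOddAt-series h k 0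
    -- Consecutive coefficients of `series h (suc k)` are odd, so their differences are even; hence
    -- `series h k` has its last odd coefficient, the constant term 1, at index 0.
    ( (λ even → 2∤1 (subst (+ 2 ∣_) (trans (series-0 h k) h0≡1) even))
    , λ { (suc m) _ → ∣m+n∣m⇒∣n (subst (+ 2 ∣_) (split m) (odd (suc m))) (odd m) }))
  where
  split : ∀ m → + 1 ℤ.+ series h (suc k) (suc m) ≡ + 1 ℤ.+ series h (suc k) m ℤ.+ series h k (suc m)
  split m = trans (cong (ℤ._+_ (+ 1)) (series-suc h k m)) (sym (ℤ.+-assoc (+ 1) (series h (suc k) m) _))

-- γ-positivity

-- The body of `GammaPositive` with the degree as a parameter, so that several polynomials can be
-- required to share it.
GammaPositiveOfDegree : ℕ → (ℕ → ℤ) → Set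
GammaPositiveOfDegree n f =
  (f n ≢ + 0) × (∀ i → n < i → f i ≡ + 0) ×
  (∀ i → i ≤ n → f i ≡ f (n ∸ i)) ×
  Σ (ℕ → ℤ) λ γ → (∀ j → + 0 ℤ.≤ γ j) ×
    (∀ i → f i ≡ sumTo (λ j → γ j * + gammaBasis n j i) (n / 2))

-- By palindromicity the last nonzero coefficient is h 0 = 1.
gammaPositive-degree : ∀ {h k} → h 0 ≡ + 1 → EndsOddAt k h → GammaPositive h → GammaPositiveOfDegree k h
gammaPositive-degree {h} {k} h0≡1 (odd , even) (n , rest@(_ , vanish , palindromic , _)) =
  subst (λ n → GammaPositiveOfDegree n h) (ℕ.≤-antisym n≤k k≤n) rest
  where
  hn≡1 : h n ≡ + 1
  hn≡1 = trans (palindromic n ℕ.≤-refl) (trans (cong h (ℕ.n∸n≡0 n)) h0≡1)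

  n≤k : n ≤ k
  n≤k = ℕ.≮⇒≥ λ k<n → 2∤1 (subst (+ 2 ∣_) hn≡1 (even n k<n))

  k≤n : k ≤ n
  k≤n = ℕ.≮⇒≥ λ n<k → odd (divides (+ 0) (vanish k n<k))

-- The polynomial x^j (1+x)^{n-2j} begins with x^j, with coefficient 1. With `gammaBasis-above`,
-- this makes the first rows of the γ-expansion unitriangular.
gammaBasis-diag : ∀ n i → gammaBasis n i i ≡ 1
gammaBasis-diag n i with i ≤ᵇ i in eq
... | true  rewrite ℕ.n∸n≡0 i = refl
... | false = ⊥-elim (subst T eq (ℕ.≤⇒≤ᵇ (ℕ.≤-refl {i})))

gammaBasis-above : ∀ n {j i} → i < j → gammaBasis n j i ≡ 0
gammaBasis-above n {j} {i} i<j with j ≤ᵇ i in eq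
... | true  = ⊥-elim (ℕ.<⇒≱ i<j (ℕ.≤ᵇ⇒≤ j i (subst T (sym eq) _)))
... | false = refl

-- With a common n all expansions use the same basis, so the γ-vectors add up to a vector `Γ`
-- expanding `suc c` times h. Its entries are nonnegative, and unitriangularity makes them divisible
-- by `suc c`.
average-gammaPositive : ∀ (es : List A) (f : A → ℕ → ℤ) {h : ℕ → ℤ} c n →
  (∀ i → +[1+ c ] * h i ≡ sumOver es (λ e → f e i)) → h n ≢ + 0 →
  (∀ e → GammaPositiveOfDegree n (f e)) → GammaPositive h
average-gammaPositive es f {h} c n ch≡f hn≢0 positive =
  n , hn≢0 , vanish , palindromic , γ , γ-nonNeg , expand
  where
  open ≡-Reasoning

  cancel : ∀ {a b} → +[1+ c ] * a ≡ +[1+ c ] * b → a ≡ b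
  cancel {a} {b} = ℤ.*-cancelˡ-≡ +[1+ c ] a b

  vanish : ∀ i → n < i → h i ≡ + 0
  vanish i n<i = cancel (begin
    +[1+ c ] * h i           ≡⟨ ch≡f i ⟩
    sumOver es (λ e → f e i) ≡⟨ sumOver-cong es (λ e → proj₁ (proj₂ (positive e)) i n<i) ⟩
    sumOver es (λ _ → + 0)   ≡⟨ sumOver-0 es ⟩
    + 0                      ≡⟨ ℤ.*-zeroʳ +[1+ c ] ⟨
    +[1+ c ] * + 0           ∎)

  palindromic : ∀ i → i ≤ n → h i ≡ h (n ∸ i)
  palindromic i i≤n = cancel (begin
    +[1+ c ] * h i                 ≡⟨ ch≡f i ⟩
    sumOver es (λ e → f e i)       ≡⟨ sumOver-cong es (λ e → proj₁ (proj₂ (proj₂ (positive e))) i i≤n) ⟩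
    sumOver es (λ e → f e (n ∸ i)) ≡⟨ ch≡f (n ∸ i) ⟨
    +[1+ c ] * h (n ∸ i)           ∎)

  γs : ∀ e → Σ (ℕ → ℤ) λ γ → (∀ j → + 0 ℤ.≤ γ j) ×
    (∀ i → f e i ≡ sumTo (λ j → γ j * + gammaBasis n j i) (n / 2))
  γs e = proj₂ (proj₂ (proj₂ (positive e)))

  Γ : ℕ → ℤ
  Γ j = sumOver es (λ e → proj₁ (γs e) j)

  Γ-expand : ∀ i → +[1+ c ] * h i ≡ sumTo (λ j → Γ j * + gammaBasis n j i) (n / 2)
  Γ-expand i = begin
    +[1+ c ] * h i           ≡⟨ ch≡f i ⟩
    sumOver es (λ e → f e i) ≡⟨ sumOver-cong es (λ e → proj₂ (proj₂ (γs e)) i) ⟩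
    sumOver es (λ e → sumTo (λ j → proj₁ (γs e) j * + gammaBasis n j i) (n / 2))
      ≡⟨ sumOver-sumTo es (λ e → proj₁ (γs e)) (λ j → + gammaBasis n j i) (n / 2) ⟩
    sumTo (λ j → Γ j * + gammaBasis n j i) (n / 2) ∎

  -- The rows i ≤ n/2 suffice: in each of them only the terms j ≤ i survive, and the right-hand side
  -- is a multiple of `suc c`.
  c∣Γ : ∀ j → j ≤ n / 2 → +[1+ c ] ∣ Γ j
  c∣Γ = unitriangular-∣ Γ (λ i j → gammaBasis n j i) (gammaBasis-diag n) (n / 2) λ i i≤n/2 →
    divides (h i) (begin
      sumTo (λ j → Γ j * + gammaBasis n j i) i
        ≡⟨ sumTo-truncate _ i≤n/2 (λ j i<j →
            trans (cong (λ b → Γ j * + b) (gammaBasis-above n i<j)) (ℤ.*-zeroʳ (Γ j))) ⟨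
      sumTo (λ j → Γ j * + gammaBasis n j i) (n / 2) ≡⟨ Γ-expand i ⟨
      +[1+ c ] * h i                                 ≡⟨ ℤ.*-comm +[1+ c ] (h i) ⟩
      h i * +[1+ c ]                                 ∎)

  quotient : ∀ j → Σ ℤ λ q → + 0 ℤ.≤ q × (j ≤ n / 2 → +[1+ c ] * q ≡ Γ j)
  quotient j with j ℕ.≤? n / 2
  -- Entries beyond n/2 do not enter the expansion, so 0 serves as a nonnegative default there.
  ... | no  j≰n/2 = + 0 , ℤ.≤-refl , λ j≤n/2 → ⊥-elim (j≰n/2 j≤n/2)
  ... | yes j≤n/2 with c∣Γ j j≤n/2
  ...   | divides q Γ≡qc =
    q ,
    ℤ.*-cancelʳ-≤-pos (+ 0) q +[1+ c ]
      (subst (+ 0 ℤ.≤_) Γ≡qc (sumOver-nonNeg es (λ e → proj₁ (proj₂ (γs e)) j))) ,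
    λ _ → trans (ℤ.*-comm +[1+ c ] q) (sym Γ≡qc)

  γ : ℕ → ℤ
  γ = proj₁ ∘ quotient

  γ-nonNeg : ∀ j → + 0 ℤ.≤ γ j
  γ-nonNeg = proj₁ ∘ proj₂ ∘ quotient

  expand : ∀ i → h i ≡ sumTo (λ j → γ j * + gammaBasis n j i) (n / 2)
  expand i = cancel (trans (Γ-expand i) (sym
    (sumTo-scale +[1+ c ] (λ j → + gammaBasis n j i) (n / 2) (proj₂ ∘ proj₂ ∘ quotient))))

-- Lists without repetition

∈-drop-middle : ∀ {x y : A} as {bs} → y ≢ x → y ∈ as ++ x ∷ bs → y ∈ as ++ bs
∈-drop-middle as y≢x y∈ with ∈-++⁻ as y∈
... | inj₁ y∈as         = ∈-++⁺ˡ y∈as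
... | inj₂ (here y≡x)   = ⊥-elim (y≢x y≡x)
... | inj₂ (there y∈bs) = ∈-++⁺ʳ as y∈bs

-- Delete one occurrence of the head of xs from ys: the tail does not contain the head, so it is
-- still included in what remains.
unique-⊆⇒length≤ : ∀ {xs ys : List A} → Unique xs → (∀ {x} → x ∈ xs → x ∈ ys) → length xs ≤ length ys
unique-⊆⇒length≤ [] xs⊆ys = z≤n
unique-⊆⇒length≤ {xs = x ∷ xs} (x∉xs ∷ unique-xs) xs⊆ys with ∈-∃++ (xs⊆ys (here refl))
... | as , bs , refl = begin
  suc (length xs)             ≤⟨ s≤s (unique-⊆⇒length≤ unique-xs xs⊆as++bs) ⟩
  suc (length (as ++ bs))     ≡⟨ cong suc (length-++ as) ⟩
  suc (length as + length bs) ≡⟨ ℕ.+-suc (length as) (length bs) ⟨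
  length as + suc (length bs) ≡⟨ length-++ as ⟨
  length (as ++ x ∷ bs)       ∎
  where
  open ℕ.≤-Reasoning
  xs⊆as++bs : ∀ {y} → y ∈ xs → y ∈ as ++ bs
  xs⊆as++bs y∈xs = ∈-drop-middle as (λ { refl → All¬⇒¬Any x∉xs y∈xs }) (xs⊆ys (there y∈xs))

unique-⇔⇒length≡ : ∀ {xs ys : List A} → Unique xs → Unique ys → (∀ x → x ∈ xs ⇔ x ∈ ys) →
  length xs ≡ length ys
unique-⇔⇒length≡ unique-xs unique-ys xs⇔ys = ℕ.≤-antisym
  (unique-⊆⇒length≤ unique-xs (to (xs⇔ys _)))
  (unique-⊆⇒length≤ unique-ys (from (xs⇔ys _)))

pairs : List A → (A → List B) → List (A × B)
pairs es f = concatMap (λ e → map (e ,_) (f e)) es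

length-pairs : ∀ (es : List A) (f : A → List B) → + length (pairs es f) ≡ sumOver es (λ e → + length (f e))
length-pairs []       f = refl
length-pairs (e ∷ es) f = begin
  + length (map (e ,_) (f e) ++ pairs es f)        ≡⟨ cong +_ (length-++ (map (e ,_) (f e))) ⟩
  + (length (map (e ,_) (f e)) + length (pairs es f))
    ≡⟨ cong₂ (λ a b → + a ℤ.+ b) (length-map (e ,_) (f e)) (length-pairs es f) ⟩
  + length (f e) ℤ.+ sumOver es (λ e → + length (f e)) ∎
  where open ≡-Reasoning

∈-pairs⁺ : ∀ {es : List A} (f : A → List B) {e b} → e ∈ es → b ∈ f e → (e , b) ∈ pairs es f
∈-pairs⁺ f (here refl)          b∈ = ∈-++⁺ˡ (∈-map⁺ _ b∈)
∈-pairs⁺ {es = e ∷ _} f (there e∈) b∈ = ∈-++⁺ʳ (map (e ,_) (f e)) (∈-pairs⁺ f e∈ b∈)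

∈-pairs⁻ : ∀ (es : List A) (f : A → List B) {e b} → (e , b) ∈ pairs es f → e ∈ es × b ∈ f e
∈-pairs⁻ (e ∷ es) f p with ∈-++⁻ (map (e ,_) (f e)) p
... | inj₂ q with ∈-pairs⁻ es f q
...   | e∈ , b∈ = there e∈ , b∈
∈-pairs⁻ (e ∷ es) f p | inj₁ q with ∈-map⁻ (e ,_) q
...   | _ , b∈ , refl = here refl , b∈

unique-pairs : ∀ {es : List A} (f : A → List B) → Unique es → (∀ e → Unique (f e)) → Unique (pairs es f)
unique-pairs f [] unique-f = []
unique-pairs {es = e ∷ es} f (e∉es ∷ unique-es) unique-f = Unique.++⁺
  (Unique.map⁺ ,-injectiveʳ (unique-f e))
  (unique-pairs f unique-es unique-f)
  λ { (p , q) → disjoint p q }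
  where
  disjoint : ∀ {p} → p ∈ map (e ,_) (f e) → p ∉ pairs es f
  disjoint p q with ∈-map⁻ (e ,_) p
  ... | _ , _ , refl = All¬⇒¬Any e∉es (proj₁ (∈-pairs⁻ es f q))

-- Enumeration of the sign vectors

∈-allSigns : (ε : Vec Bool d) → ε ∈ allSigns d
∈-allSigns []          = here refl
∈-allSigns (true  ∷ ε) = ∈-++⁺ˡ (∈-map⁺ _ (∈-allSigns ε))
∈-allSigns (false ∷ ε) = ∈-++⁺ʳ _ (∈-map⁺ _ (∈-allSigns ε))

unique-allSigns : ∀ d → Unique (allSigns d)
unique-allSigns zero    = All.[] ∷ []
unique-allSigns (suc d) = Unique.++⁺
  (Unique.map⁺ Vec.∷-injectiveʳ (unique-allSigns d))
  (Unique.map⁺ Vec.∷-injectiveʳ (unique-allSigns d))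
  λ { (p , q) → disjoint p q }
  where
  disjoint : ∀ {ε} → ε ∈ map (true ∷_) (allSigns d) → ε ∉ map (false ∷_) (allSigns d)
  disjoint p q with ∈-map⁻ _ p | ∈-map⁻ _ q
  ... | _ , _ , refl | _ , _ , ()

length-allSigns : ∀ d → length (allSigns d) ≡ 2 ^ d
length-allSigns zero    = refl
length-allSigns (suc d) = begin
  length (map (true ∷_) (allSigns d) ++ map (false ∷_) (allSigns d))
    ≡⟨ length-++ (map (true ∷_) (allSigns d)) ⟩
  length (map (true ∷_) (allSigns d)) + length (map (false ∷_) (allSigns d))
    ≡⟨ cong₂ _+_ (length-map _ (allSigns d)) (length-map _ (allSigns d)) ⟩
  length (allSigns d) + length (allSigns d)
    ≡⟨ cong₂ _+_ (length-allSigns d) (trans (length-allSigns d) (sym (ℕ.+-identityʳ (2 ^ d)))) ⟩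
  2 ^ suc d ∎
  where open ≡-Reasoning

-- Coordinate reflections of lattice points and regions

signℤ : Bool → ℤ → ℤ
signℤ true  z = z
signℤ false z = ℤ.- z

reflect : Vec Bool d → Vec ℤ d → Vec ℤ d
reflect = zipWith signℤ

toℚ-neg : ∀ z → toℚ (ℤ.- z) ≡ ℚ.- toℚ z
toℚ-neg (+ zero)  = refl
toℚ-neg +[1+ n ]  = refl
toℚ-neg -[1+ n ]  = sym (⁻¹-involutive _)

toℚᵛ-reflect : ∀ (δ : Vec Bool d) z → toℚᵛ (reflect δ z) ≡ applySign δ (toℚᵛ z)
toℚᵛ-reflect []          []      = refl
toℚᵛ-reflect (true  ∷ δ) (z ∷ zs) = cong (toℚ z ∷_) (toℚᵛ-reflect δ zs)
toℚᵛ-reflect (false ∷ δ) (z ∷ zs) = cong₂ _∷_ (toℚ-neg z) (toℚᵛ-reflect δ zs)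

dilate-applySign : ∀ r (δ : Vec Bool d) x →
  Vec.map (r ℚ.*_) (applySign δ x) ≡ applySign δ (Vec.map (r ℚ.*_) x)
dilate-applySign r []          []       = refl
dilate-applySign r (true  ∷ δ) (q ∷ x) = cong (r ℚ.* q ∷_) (dilate-applySign r δ x)
dilate-applySign r (false ∷ δ) (q ∷ x) = cong₂ _∷_ (sym (ℚ.neg-distribʳ-* r q)) (dilate-applySign r δ x)

Unconditional : Region d → Set
Unconditional {d} R = ∀ δ {x : Pt d} → R x → R (applySign δ x)

-- Division in the group ±1, with `true` as +1. If ε carries x into R, then ε divided by δ carries
-- the reflected point `applySign δ x` into R.
signQuotient : Bool → Bool → Bool
signQuotient a true  = a
signQuotient a false = not a

applySign-quotient : ∀ (ε δ : Vec Bool d) x →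
  applySign (zipWith signQuotient ε δ) (applySign δ x) ≡ applySign ε x
applySign-quotient []          []          []       = refl
applySign-quotient (e ∷ ε)     (true ∷ δ)  (q ∷ x) = cong (signℚ e q ∷_) (applySign-quotient ε δ x)
applySign-quotient (true ∷ ε)  (false ∷ δ) (q ∷ x) = cong₂ _∷_ (⁻¹-involutive q) (applySign-quotient ε δ x)
applySign-quotient (false ∷ ε) (false ∷ δ) (q ∷ x) = cong (ℚ.- q ∷_) (applySign-quotient ε δ x)

Pm-unconditional : (R : Region d) → Unconditional (Pm R)
Pm-unconditional R δ {x} (ε , Rεx) =
  zipWith signQuotient ε δ , subst R (sym (applySign-quotient ε δ x)) Rεx

InDilate-reflect : ∀ (R : Region d) m → Unconditional R → ∀ δ {z} →
  InDilate R m z → InDilate R m (reflect δ z)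
InDilate-reflect R m unc δ {z} (x , Rx , mx≡z) = applySign δ x , unc δ Rx ,
  trans (dilate-applySign (toℚ (+ m)) δ x) (trans (cong (applySign δ) mx≡z) (sym (toℚᵛ-reflect δ z)))

OrthCoord-cancel : ∀ b r .{{_ : ℚ.Positive r}} {q} → OrthCoord b (r ℚ.* q) → OrthCoord b q
OrthCoord-cancel true  r {q} 0≤rq = ℚ.*-cancelˡ-≤-pos r (subst (ℚ._≤ r ℚ.* q) (sym (ℚ.*-zeroʳ r)) 0≤rq)
OrthCoord-cancel false r {q} rq≤0 = ℚ.*-cancelˡ-≤-pos r (subst (r ℚ.* q ℚ.≤_) (sym (ℚ.*-zeroʳ r)) rq≤0)

-- Scaling by a positive factor can be undone without leaving the orthant; this is why the factor is
-- `suc m`.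
InOrthant-dilate : ∀ m (ε : Vec Bool d) {x z} → Vec.map (toℚ (+ suc m) ℚ.*_) x ≡ toℚᵛ z →
  InOrthant ε (toℚᵛ z) → InOrthant ε x
InOrthant-dilate m ε {x} {z} mx≡z z∈ε i =
  OrthCoord-cancel (lookup ε i) (toℚ (+ suc m)) {{ℚ.normalize-pos (suc m) 1}}
  (subst (OrthCoord (lookup ε i)) lookup-mx (z∈ε i))
  where
  lookup-mx : lookup (toℚᵛ z) i ≡ toℚ (+ suc m) ℚ.* lookup x i
  lookup-mx = trans (cong (λ y → lookup y i) (sym mx≡z)) (Vec.lookup-map i _ x)

InDilate-orthant : ∀ {R Q : Region d} m (ε : Vec Bool d) {z} → (∀ x → InOrthant ε x → R x → Q x) →
  InOrthant ε (toℚᵛ z) → InDilate R (suc m) z → InDilate Q (suc m) z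
InDilate-orthant m ε R⊆Q z∈ε (x , Rx , mx≡z) = x , R⊆Q x (InOrthant-dilate m ε mx≡z z∈ε) Rx , mx≡z

-- Exchanging the sign of a coordinate with an auxiliary sign

-- Zero has no sign to give away, so the auxiliary sign stays; both pairs over 0 are then fixed and
-- the exchange remains an involution.
orient : Bool → ℤ → Bool
orient b (+ zero) = b
orient b +[1+ n ] = true
orient b -[1+ n ] = false

place : Bool → ℤ → ℤ
place b z = signℤ b (+ ∣ z ∣)

-- The product of b and the sign of z, with zero counted as positive: the reflection that takes z to
-- `place b z`.
placeSign : Bool → ℤ → Bool
placeSign b (+ n)    = b
placeSign b -[1+ n ] = not b

orient-place : ∀ b z → orient (orient b z) (place b z) ≡ b
orient-place true  (+ zero) = refl
orient-place true  +[1+ n ] = refl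
orient-place true  -[1+ n ] = refl
orient-place false (+ zero) = refl
orient-place false +[1+ n ] = refl
orient-place false -[1+ n ] = refl

place-place : ∀ b z → place (orient b z) (place b z) ≡ z
place-place true  (+ zero) = refl
place-place true  +[1+ n ] = refl
place-place true  -[1+ n ] = refl
place-place false (+ zero) = refl
place-place false +[1+ n ] = refl
place-place false -[1+ n ] = refl

place-signℤ : ∀ b z → place b z ≡ signℤ (placeSign b z) z
place-signℤ b     (+ n)    = refl
place-signℤ true  -[1+ n ] = refl
place-signℤ false -[1+ n ] = refl

OrthCoord-place : ∀ b z → OrthCoord b (toℚ (place b z))
OrthCoord-place true  z = ℚ.nonNegative⁻¹ (toℚ (+ ∣ z ∣)) {{ℚ.normalize-nonNeg ∣ z ∣ 1}}
OrthCoord-place false z = subst (ℚ._≤ 0ℚ) (sym (toℚ-neg (+ ∣ z ∣)))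
  (ℚ.neg-antimono-≤ (OrthCoord-place true z))

exchange : Vec Bool d × Vec ℤ d → Vec Bool d × Vec ℤ d
exchange (ε , z) = zipWith orient ε z , zipWith place ε z

exchange-involutive : (p : Vec Bool d × Vec ℤ d) → exchange (exchange p) ≡ p
exchange-involutive (ε , z) = cong₂ _,_ (signs ε z) (points ε z)
  where
  signs : ∀ {d} (ε : Vec Bool d) z → zipWith orient (zipWith orient ε z) (zipWith place ε z) ≡ ε
  signs []      []      = refl
  signs (b ∷ ε) (z ∷ zs) = cong₂ _∷_ (orient-place b z) (signs ε zs)

  points : ∀ {d} (ε : Vec Bool d) z → zipWith place (zipWith orient ε z) (zipWith place ε z) ≡ z
  points []      []      = refl
  points (b ∷ ε) (z ∷ zs) = cong₂ _∷_ (place-place b z) (points ε zs)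

InOrthant-place : ∀ (ε : Vec Bool d) z → InOrthant ε (toℚᵛ (zipWith place ε z))
InOrthant-place (b ∷ ε) (z ∷ zs) zero    = OrthCoord-place b z
InOrthant-place (b ∷ ε) (z ∷ zs) (suc i) = InOrthant-place ε zs i

place-reflect : ∀ (ε : Vec Bool d) z → zipWith place ε z ≡ reflect (zipWith placeSign ε z) z
place-reflect []      []       = refl
place-reflect (b ∷ ε) (z ∷ zs) = cong₂ _∷_ (place-signℤ b z) (place-reflect ε zs)

-- By involutivity z is itself the point placed by the exchanged pair, and a placed point lies in
-- the orthant of its sign vector.
InOrthant-exchange : ∀ (ε : Vec Bool d) z → InOrthant (proj₁ (exchange (ε , z))) (toℚᵛ z)
InOrthant-exchange ε z = subst (λ w → InOrthant (proj₁ (exchange (ε , z))) (toℚᵛ w))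
  (cong proj₂ (exchange-involutive (ε , z)))
  (InOrthant-place (proj₁ (exchange (ε , z))) (proj₂ (exchange (ε , z))))

-- Lattice points of a region that agrees with an unconditional region in each orthant

module OrthantCount (R : Region d) (Q : Vec Bool d → Region d)
  (unconditional : ∀ ε → Unconditional (Q ε))
  (R⇔Q : ∀ ε x → InOrthant ε x → R x ⇔ Q ε x)
  (m : ℕ) (count : ∀ ε → Σ ℕ (LatticeCount (Q ε) (suc m))) where

  points : Vec Bool d → List (Vec ℤ d)
  points ε = proj₁ (proj₂ (count ε))

  unique-points : ∀ ε → Unique (points ε)
  unique-points ε = proj₁ (proj₂ (proj₂ (count ε)))

  ∈-points : ∀ ε z → z ∈ points ε ⇔ InDilate (Q ε) (suc m) z
  ∈-points ε = proj₁ (proj₂ (proj₂ (proj₂ (count ε))))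

  length-points : ∀ ε → length (points ε) ≡ proj₁ (count ε)
  length-points ε = proj₂ (proj₂ (proj₂ (proj₂ (count ε))))

  ∈-points-orthant : ∀ ε z → InOrthant ε (toℚᵛ z) → z ∈ points ε ⇔ InDilate R (suc m) z
  ∈-points-orthant ε z z∈ε = mk⇔
    (InDilate-orthant m ε (λ x x∈ε → from (R⇔Q ε x x∈ε)) z∈ε ∘ to (∈-points ε z))
    (from (∈-points ε z) ∘ InDilate-orthant m ε (λ x x∈ε → to (R⇔Q ε x x∈ε)) z∈ε)

  reflect-points : ∀ ε δ {z} → z ∈ points ε → reflect δ z ∈ points ε
  reflect-points ε δ = from (∈-points ε _) ∘ InDilate-reflect (Q ε) (suc m) (unconditional ε) δ ∘ to (∈-points ε _)

  -- One orthant containing z, zero coordinates being counted as positive.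
  orthantOf : Vec ℤ d → Vec Bool d
  orthantOf z = proj₁ (exchange (replicate d true , z))

  _≟_ = Vec.≡-dec {n = d} ℤ._≟_

  -- A decision procedure for the dilate of R: in the orthant chosen for z, R coincides with a
  -- region whose points are listed.
  inOwn? = λ z → DecMembership._∈?_ _≟_ z (points (orthantOf z))

  -- A finite superset of the lattice points sought. The lists of different sign vectors overlap,
  -- hence the deduplication.
  candidates : List (Vec ℤ d)
  candidates = deduplicate _≟_ (concatMap points (allSigns d))

  regionPoints : List (Vec ℤ d)
  regionPoints = filter inOwn? candidates

  unique-regionPoints : Unique regionPoints
  unique-regionPoints = Unique.filter⁺ inOwn? (DecUnique.deduplicate-! _≟_ (concatMap points (allSigns d)))

  ∈-own : ∀ z → z ∈ points (orthantOf z) ⇔ InDilate R (suc m) z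
  ∈-own z = ∈-points-orthant (orthantOf z) z (InOrthant-exchange (replicate d true) z)

  ∈-regionPoints : ∀ z → z ∈ regionPoints ⇔ InDilate R (suc m) z
  ∈-regionPoints z = mk⇔
    (to (∈-own z) ∘ proj₂ ∘ ∈-filter⁻ inOwn? {xs = candidates})
    λ z∈mR → let z∈own = from (∈-own z) z∈mR in
      ∈-filter⁺ inOwn? (∈-deduplicate⁺ _≟_ (∈-concatMap⁺ points (lose (∈-allSigns (orthantOf z)) z∈own))) z∈own

  latticeCount : LatticeCount R (suc m) (length regionPoints)
  latticeCount = regionPoints , unique-regionPoints , ∈-regionPoints , refl

  signedPoints exchangedPoints regionPairs : List (Vec Bool d × Vec ℤ d)
  signedPoints    = pairs (allSigns d) points
  exchangedPoints = map exchange signedPoints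
  regionPairs     = pairs (allSigns d) (λ _ → regionPoints)

  -- The point w is a reflection of z, so both or neither lie in the dilate of `Q ε`; as w is in the
  -- orthant of ε, this is membership in the dilate of R. The new sign vector η is unconstrained,
  -- which produces the factor 2^d.
  exchange-∈ : ∀ p → p ∈ signedPoints ⇔ exchange p ∈ regionPairs
  exchange-∈ (ε , z) = mk⇔
    (λ p∈ → ∈-pairs⁺ (λ _ → regionPoints) (∈-allSigns _)
      (from (∈-regionPoints w) (to (∈-points-orthant ε w w∈ε)
        (subst (_∈ points ε) (sym (place-reflect ε z))
          (reflect-points ε (zipWith placeSign ε z) (proj₂ (∈-pairs⁻ (allSigns d) points p∈)))))))
    -- Conversely, involutivity presents z as the reflection of w by `placeSign η w`.
    (λ p∈ → ∈-pairs⁺ points (∈-allSigns _)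
      (subst (_∈ points ε) (trans (sym (place-reflect η w)) (cong proj₂ (exchange-involutive (ε , z))))
        (reflect-points ε (zipWith placeSign η w)
          (from (∈-points-orthant ε w w∈ε)
            (to (∈-regionPoints w) (proj₂ (∈-pairs⁻ (allSigns d) (λ _ → regionPoints) p∈)))))))
    where
    η = proj₁ (exchange (ε , z))
    w = proj₂ (exchange (ε , z))
    w∈ε : InOrthant ε (toℚᵛ w)
    w∈ε = InOrthant-place ε z

  length-regionPairs : length exchangedPoints ≡ length regionPairs
  length-regionPairs = unique-⇔⇒length≡
    (Unique.map⁺ exchange-injective (unique-pairs points (unique-allSigns d) unique-points))
    (unique-pairs _ (unique-allSigns d) (λ _ → unique-regionPoints))
    λ p → mk⇔ (forth p) (back p)
    where
    exchange-injective : ∀ {p q : Vec Bool d × Vec ℤ d} → exchange p ≡ exchange q → p ≡ q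
    exchange-injective {p} {q} eq =
      trans (sym (exchange-involutive p)) (trans (cong exchange eq) (exchange-involutive q))

    forth : ∀ p → p ∈ exchangedPoints → p ∈ regionPairs
    forth p p∈ with ∈-map⁻ exchange p∈
    ... | q , q∈ , refl = to (exchange-∈ q) q∈

    back : ∀ p → p ∈ regionPairs → p ∈ exchangedPoints
    back p p∈ = subst (_∈ exchangedPoints) (exchange-involutive p)
      (∈-map⁺ exchange (from (exchange-∈ (exchange p)) (subst (_∈ regionPairs) (sym (exchange-involutive p)) p∈)))

  count-average : + (2 ^ d) * + length regionPoints ≡ sumOver (allSigns d) (λ ε → + proj₁ (count ε))
  count-average = begin
    + (2 ^ d) * + n                                   ≡⟨ cong (λ k → + k * + n) (length-allSigns d) ⟨
    + length (allSigns d) * + n                       ≡⟨ sumOver-const (allSigns d) ⟨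
    sumOver (allSigns d) (λ _ → + n)                  ≡⟨ length-pairs (allSigns d) _ ⟨
    + length regionPairs                              ≡⟨ cong +_ length-regionPairs ⟨
    + length exchangedPoints                          ≡⟨ cong +_ (length-map exchange signedPoints) ⟩
    + length signedPoints                             ≡⟨ length-pairs (allSigns d) points ⟩
    sumOver (allSigns d) (λ ε → + length (points ε))
      ≡⟨ sumOver-cong (allSigns d) (λ ε → cong +_ (length-points ε)) ⟩
    sumOver (allSigns d) (λ ε → + proj₁ (count ε))    ∎
    where
    open ≡-Reasoning
    n = length regionPoints

    sumOver-const : ∀ {A : Set} (es : List A) → sumOver es (λ _ → + n) ≡ + length es * + n
    sumOver-const []       = refl
    sumOver-const (e ∷ es) = trans (cong (ℤ._+_ (+ n)) (sumOver-const es)) (sym (ℤ.suc-* (+ length es) (+ n)))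

-- Parity of the number of lattice points

origin : Vec ℤ d
origin = replicate _ (+ 0)

negate : Vec ℤ d → Vec ℤ d
negate = reflect (replicate _ false)

negate-origin : ∀ d → negate {d} origin ≡ origin
negate-origin zero    = refl
negate-origin (suc d) = cong (+ 0 ∷_) (negate-origin d)

negate-involutive : (z : Vec ℤ d) → negate (negate z) ≡ z
negate-involutive []       = refl
negate-involutive (z ∷ zs) = cong₂ _∷_ (ℤ.neg-involutive z) (negate-involutive zs)

-- Selects exactly one of z and -z for every nonzero z.
lexPositive : Vec ℤ d → Bool
lexPositive []             = false
lexPositive (+ zero  ∷ z)  = lexPositive z
lexPositive (+[1+ _ ] ∷ _) = true
lexPositive (-[1+ _ ] ∷ _) = false

lexPositive-origin : ∀ d → lexPositive (origin {d}) ≡ false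
lexPositive-origin zero    = refl
lexPositive-origin (suc d) = lexPositive-origin d

lexPositive-negate : (z : Vec ℤ d) → lexPositive z ≡ true → lexPositive (negate z) ≡ false
lexPositive-negate (+ zero   ∷ z) z>0 = lexPositive-negate z z>0
lexPositive-negate (+[1+ _ ] ∷ z) z>0 = refl

lexPositive-cases : (z : Vec ℤ d) → z ≡ origin ⊎ lexPositive z ≡ true ⊎ lexPositive (negate z) ≡ true
lexPositive-cases []             = inj₁ refl
lexPositive-cases (+[1+ _ ] ∷ _) = inj₂ (inj₁ refl)
lexPositive-cases (-[1+ _ ] ∷ _) = inj₂ (inj₂ refl)
lexPositive-cases (+ zero ∷ z) with lexPositive-cases z
... | inj₁ z≡0 = inj₁ (cong (+ 0 ∷_) z≡0)
... | inj₂ z≷0 = inj₂ z≷0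

-- L consists of the origin, its lexicographically positive points P and their negatives, so 1 + |L|
-- = 2(1 + |P|). Oddness is phrased as divisibility of the successor to suit the later parity
-- arguments.
symmetric⇒odd : ∀ {L : List (Vec ℤ d)} → Unique L → origin ∈ L → (∀ {z} → z ∈ L → negate z ∈ L) →
  + 2 ∣ + 1 ℤ.+ + length L
symmetric⇒odd {d} {L} unique-L 0∈L closed = divides (+ suc (length P)) (begin
  + suc (length L)
    ≡⟨ cong (+_ ∘ suc) (unique-⇔⇒length≡ unique-L unique-S λ z → mk⇔ (L⊆S z) (S⊆L z)) ⟩
  + (2 + length (P ++ map negate P))
    ≡⟨ cong (λ k → + (2 + k)) (trans (length-++ P) (cong (_+_ (length P)) (length-map negate P))) ⟩
  + (2 + (length P + length P))
    ≡⟨ cong (λ k → + (2 + k)) (trans (cong (_+_ (length P)) (sym (ℕ.+-identityʳ _))) (ℕ.*-comm 2 (length P))) ⟩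
  + (suc (length P) ℕ.* 2)
    ≡⟨ ℤ.pos-* (suc (length P)) 2 ⟩
  + suc (length P) * + 2 ∎)
  where
  open ≡-Reasoning
  positive? = λ z → lexPositive {d} z Bool.≟ true

  P : List (Vec ℤ d)
  P = filter positive? L

  S : List (Vec ℤ d)
  S = origin ∷ P ++ map negate P

  positive : ∀ {z} → z ∈ P → lexPositive z ≡ true
  positive z∈P = proj₂ (∈-filter⁻ positive? {xs = L} z∈P)

  true≢false : true ≢ false
  true≢false ()

  0∉ : origin ∉ P ++ map negate P
  0∉ 0∈ with ∈-++⁻ P 0∈
  ... | inj₁ 0∈P = true≢false (trans (sym (positive 0∈P)) (lexPositive-origin d))
  ... | inj₂ 0∈-P with ∈-map⁻ negate 0∈-P
  ...   | z , z∈P , 0≡-z = true≢false (trans (sym (positive z∈P)) (trans (cong lexPositive z≡0) (lexPositive-origin d)))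
    where
    z≡0 : z ≡ origin
    z≡0 = trans (sym (negate-involutive z)) (trans (cong negate (sym 0≡-z)) (negate-origin d))

  disjoint : ∀ {z} → z ∈ P → z ∉ map negate P
  disjoint z∈P z∈-P with ∈-map⁻ negate z∈-P
  ... | y , y∈P , refl = true≢false (trans (sym (positive z∈P)) (lexPositive-negate y (positive y∈P)))

  unique-P : Unique P
  unique-P = Unique.filter⁺ positive? unique-L

  unique-S : Unique S
  unique-S = All.tabulate (λ { y∈ refl → 0∉ y∈ }) ∷ Unique.++⁺ unique-P
    (Unique.map⁺ (λ {x} {y} eq → trans (sym (negate-involutive x)) (trans (cong negate eq) (negate-involutive y))) unique-P)
    λ { (p , q) → disjoint p q }

  L⊆S : ∀ z → z ∈ L → z ∈ S
  L⊆S z z∈L with lexPositive-cases z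
  ... | inj₁ z≡0        = here z≡0
  ... | inj₂ (inj₁ z>0) = there (∈-++⁺ˡ (∈-filter⁺ positive? z∈L z>0))
  ... | inj₂ (inj₂ z<0) = there (∈-++⁺ʳ P
    (subst (_∈ map negate P) (negate-involutive z) (∈-map⁺ negate (∈-filter⁺ positive? (closed z∈L) z<0))))

  S⊆L : ∀ z → z ∈ S → z ∈ L
  S⊆L z (here refl) = 0∈L
  S⊆L z (there z∈) with ∈-++⁻ P z∈
  ... | inj₁ z∈P = proj₁ (∈-filter⁻ positive? z∈P)
  ... | inj₂ z∈-P with ∈-map⁻ negate z∈-P
  ...   | y , y∈P , refl = closed (proj₁ (∈-filter⁻ positive? y∈P))

-- The origin in an unconditional region, and odd counts

InDilate-origin : ∀ (R : Region d) m → R (replicate d 0ℚ) → InDilate R m origin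
InDilate-origin {d} R m R0 = replicate d 0ℚ , R0 ,
  trans (Vec.map-replicate _ 0ℚ d) (trans (cong (replicate d) (ℚ.*-zeroʳ (toℚ (+ m))))
    (sym (Vec.map-replicate toℚ (+ 0) d)))

unconditional⇒oddCount : ∀ (R : Region d) m {n} → Unconditional R → R (replicate d 0ℚ) → LatticeCount R m n →
  + 2 ∣ + 1 ℤ.+ + n
unconditional⇒oddCount R m unc R0 (L , unique-L , L⇔ , refl) = symmetric⇒odd unique-L
  (from (L⇔ origin) (InDilate-origin R m R0))
  (from (L⇔ _) ∘ InDilate-reflect R m unc _ ∘ to (L⇔ _))

sumFinℚ-0 : ∀ n → sumFinℚ {n} (λ _ → 0ℚ) ≡ 0ℚ
sumFinℚ-0 zero    = refl
sumFinℚ-0 (suc n) = trans (ℚ.+-identityˡ _) (sumFinℚ-0 n)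

sumFinℚ-cong : ∀ n {f g : Fin n → ℚ} → (∀ k → f k ≡ g k) → sumFinℚ f ≡ sumFinℚ g
sumFinℚ-cong zero    eq = refl
sumFinℚ-cong (suc n) eq = cong₂ ℚ._+_ (eq zero) (sumFinℚ-cong n (eq ∘ suc))

Conv-head : ∀ (v : Vec ℤ d) V → Conv (v ∷ V) (toℚᵛ v)
Conv-head v V = weight , weight-nonNeg ,
  trans (cong (ℚ._+_ 1ℚ) (sumFinℚ-0 (length V))) (ℚ.+-identityʳ 1ℚ) ,
  λ i → trans (cong₂ ℚ._+_
      (trans (ℚ.*-identityˡ _) (sym (Vec.lookup-map i toℚ v)))
      (trans (sumFinℚ-cong (length V) (λ k → ℚ.*-zeroˡ (toℚ (lookup (List.lookup V k) i))))
        (sumFinℚ-0 (length V))))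
    (ℚ.+-identityʳ _)
  where
  weight : Fin (suc (length V)) → ℚ
  weight zero    = 1ℚ
  weight (suc _) = 0ℚ

  weight-nonNeg : ∀ k → 0ℚ ℚ.≤ weight k
  weight-nonNeg zero    = ℚ.nonNegative⁻¹ 1ℚ
  weight-nonNeg (suc _) = ℚ.≤-refl

antiBlocking-0 : ∀ (R : Region d) y → AntiBlocking R → R y → R (replicate d 0ℚ)
antiBlocking-0 {d} R y (nonNeg , down) Ry = down y (replicate d 0ℚ) Ry λ i →
  subst (0ℚ ℚ.≤_) (sym (Vec.lookup-replicate i 0ℚ)) ℚ.≤-refl ,
  subst (ℚ._≤ lookup y i) (sym (Vec.lookup-replicate i 0ℚ)) (nonNeg y Ry i)

applySign-positive : (x : Pt d) → applySign (replicate d true) x ≡ x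
applySign-positive []      = refl
applySign-positive (q ∷ x) = cong (q ∷_) (applySign-positive x)

-- Some vertex lies in the hull, and the anti-blocking property descends from it to the origin.
Pm-Conv-0 : ∀ (V : List (Vec ℤ d)) → NonEmpty V → AntiBlocking (Conv V) → Pm (Conv V) (replicate d 0ℚ)
Pm-Conv-0 {d} (v ∷ V) _ antiBlocking = replicate d true ,
  subst (Conv (v ∷ V)) (sym (applySign-positive _))
    (antiBlocking-0 (Conv (v ∷ V)) (toℚᵛ v) antiBlocking (Conv-head v V))

-- Averaging h*-polynomials

polynomial-sumOver : ∀ (es : List A) (f : A → ℕ → ℤ) → (∀ e → Polynomial (f e)) →
  Polynomial (λ i → sumOver es (λ e → f e i))
polynomial-sumOver []       f poly = 0 , λ _ _ → refl
polynomial-sumOver (e ∷ es) f poly with poly e | polynomial-sumOver es f poly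
... | N , vanish | M , vanish′ = N ⊔ M , λ i N⊔M<i → cong₂ ℤ._+_
  (vanish  i (ℕ.≤-<-trans (ℕ.m≤m⊔n N M) N⊔M<i))
  (vanish′ i (ℕ.≤-<-trans (ℕ.m≤n⊔m N M) N⊔M<i))

-- If an integer sequence s is the mean of the series of the `f e`, the series of `total` is
-- divisible by `suc c`. Since the matrix of binomial coefficients is unitriangular, so is `total`;
-- hence the mean is an integer polynomial with series s.
module Average (es : List A) (f : A → ℕ → ℤ) (k c : ℕ) (s : ℕ → ℤ)
  (average : ∀ m → +[1+ c ] * s m ≡ sumOver es (λ e → seriesCoeff (f e) k m)) where

  total : ℕ → ℤ
  total i = sumOver es (λ e → f e i)

  seriesCoeff-total : ∀ m → +[1+ c ] * s m ≡ seriesCoeff total k m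
  seriesCoeff-total m = trans (average m) (sumOver-sumTo es f (λ j → + ((m ∸ j + k) C k)) m)

  c∣total : ∀ i → +[1+ c ] ∣ total i
  c∣total i = unitriangular-∣ total (λ m j → (m ∸ j + k) C k) (seriesCoeff-diag k) i
    (λ m _ → divides (s m) (trans (sym (seriesCoeff-total m)) (ℤ.*-comm +[1+ c ] (s m)))) i ℕ.≤-refl

  mean : ℕ → ℤ
  mean i = _∣_.quotient (c∣total i)

  mean-total : ∀ i → +[1+ c ] * mean i ≡ total i
  mean-total i = trans (ℤ.*-comm +[1+ c ] (mean i)) (sym (_∣_.equality (c∣total i)))

  seriesCoeff-mean : ∀ m → seriesCoeff mean k m ≡ s m
  seriesCoeff-mean m = ℤ.*-cancelˡ-≡ +[1+ c ] _ _ (trans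
    (sumTo-scale +[1+ c ] (λ j → + ((m ∸ j + k) C k)) m (λ j _ → mean-total j))
    (sym (seriesCoeff-total m)))

  polynomial-mean : (∀ e → Polynomial (f e)) → Polynomial mean
  polynomial-mean poly with polynomial-sumOver es f poly
  ... | N , vanish = N , λ i N<i → ℤ.*-cancelˡ-≡ +[1+ c ] _ _
    (trans (mean-total i) (trans (vanish i N<i) (sym (ℤ.*-zeroʳ +[1+ c ]))))

theorem0p1 : (d : ℕ) (V : List (Vec ℤ d)) (W : Vec Bool d → List (Vec ℤ d)) →
    NonEmpty V → FullDim V →
    (∀ ε → NonEmpty (W ε)) → (∀ ε → FullDim (W ε)) →
    (∀ ε → AntiBlocking (Conv (W ε))) →
    (∀ ε x → InOrthant ε x → (Conv V x ⇔ Pm (Conv (W ε)) x)) →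
    (hε : Vec Bool d → ℕ → ℤ) →
    (∀ ε → IsHStar (Pm (Conv (W ε))) d (hε ε)) →
    Σ (ℕ → ℤ) λ h →
    IsHStar (Conv V) d h ×
    (∀ i → + (2 ^ d) * h i ≡ sumℤ (map (λ ε → hε ε i) (allSigns d))) ×
    ((∀ ε → GammaPositive (hε ε)) → GammaPositive h)
theorem0p1 d V W _ _ W≢∅ _ antiBlocking V⇔W hε hStar with 2 ^ d in 2^d≡ | ℕ.m^n>0 2 d
-- Writing the positive number 2^d as a successor makes it cancellable.
... | suc c | _ = mean ,
  ( polynomial-mean (proj₁ ∘ hStar)
  , seriesCoeff-mean 0
  , λ m → length (Count.regionPoints m) , Count.latticeCount m , sym (seriesCoeff-mean (suc m)) ) ,
  mean-total ,
  λ positive → average-gammaPositive (allSigns d) hε c d mean-total (mean-d≢0 positive) (degree-d positive)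
  where
  Q : Vec Bool d → Region d
  Q ε = Pm (Conv (W ε))

  count : ∀ m ε → Σ ℕ (LatticeCount (Q ε) (suc m))
  count m ε = proj₁ (proj₂ (proj₂ (hStar ε)) m) , proj₁ (proj₂ (proj₂ (proj₂ (hStar ε)) m))

  count≡ : ∀ m ε → + proj₁ (count m ε) ≡ seriesCoeff (hε ε) d (suc m)
  count≡ m ε = proj₂ (proj₂ (proj₂ (proj₂ (hStar ε)) m))

  module Count m = OrthantCount (Conv V) Q (λ ε → Pm-unconditional (Conv (W ε))) V⇔W m (count m)

  ehrhart : ℕ → ℤ
  -- The constant term is 1 by the convention of the h*-series; counting starts with the first
  -- dilate.
  ehrhart zero    = + 1
  ehrhart (suc m) = + length (Count.regionPoints m)

  average : ∀ m → +[1+ c ] * ehrhart m ≡ sumOver (allSigns d) (λ ε → seriesCoeff (hε ε) d m)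
  average zero = begin
    +[1+ c ] * + 1                ≡⟨ ℤ.*-identityʳ +[1+ c ] ⟩
    + suc c                       ≡⟨ cong +_ (trans (sym 2^d≡) (sym (length-allSigns d))) ⟩
    + length (allSigns d)         ≡⟨ sumOver-1 (allSigns d) ⟨
    sumOver (allSigns d) (λ _ → + 1)
      ≡⟨ sumOver-cong (allSigns d) (λ ε → proj₁ (proj₂ (hStar ε))) ⟨
    sumOver (allSigns d) (λ ε → seriesCoeff (hε ε) d 0) ∎
    where open ≡-Reasoning
  average (suc m) = trans
    (subst (λ k → + k * ehrhart (suc m) ≡ sumOver (allSigns d) (λ ε → + proj₁ (count m ε))) 2^d≡
      (Count.count-average m))
    (sumOver-cong (allSigns d) (count≡ m))

  open Average (allSigns d) hε d c ehrhart average

  hε-0 : ∀ ε → hε ε 0 ≡ + 1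
  hε-0 ε = trans (sym (seriesCoeff-0 (hε ε) d)) (proj₁ (proj₂ (hStar ε)))

  odd : ∀ ε m → + 2 ∣ + 1 ℤ.+ seriesCoeff (hε ε) d m
  odd ε zero    = divides (+ 1) (cong (ℤ._+_ (+ 1)) (proj₁ (proj₂ (hStar ε))))
  odd ε (suc m) = subst (λ n → + 2 ∣ + 1 ℤ.+ n) (count≡ m ε)
    (unconditional⇒oddCount (Q ε) (suc m) (Pm-unconditional (Conv (W ε)))
      (Pm-Conv-0 (W ε) (W≢∅ ε) (antiBlocking ε)) (proj₂ (count m ε)))

  degree-d : (∀ ε → GammaPositive (hε ε)) → ∀ ε → GammaPositiveOfDegree d (hε ε)
  degree-d positive ε = gammaPositive-degree (hε-0 ε)
    (odd-seriesCoeff⇒endsOddAt (hε ε) d (hε-0 ε) (odd ε)) (positive ε)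

  -- Palindromicity turns the constant term 1 of each `hε ε` into the coefficient at d, so the mean
  -- there is 1 as well.
  mean-d≢0 : (∀ ε → GammaPositive (hε ε)) → mean d ≢ + 0
  mean-d≢0 positive mean-d≡0 with trans (sym mean-d≡0) mean-d≡1
    where
    hε-d : ∀ ε → hε ε d ≡ + 1
    hε-d ε with degree-d positive ε
    ... | _ , _ , palindromic , _ =
      trans (palindromic d ℕ.≤-refl) (trans (cong (hε ε) (ℕ.n∸n≡0 d)) (hε-0 ε))

    mean-d≡1 : mean d ≡ + 1
    -- Each top coefficient is replaced by the constant term of the corresponding series, so that
    -- `average 0` evaluates the sum.
    mean-d≡1 = ℤ.*-cancelˡ-≡ +[1+ c ] _ _ (trans (mean-total d) (trans
      (sumOver-cong (allSigns d) (λ ε → trans (hε-d ε) (sym (proj₁ (proj₂ (hStar ε))))))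
      (sym (average 0))))
  ... | ()
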